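{- Let $q\geq 3$ be a prime power and let $(\mathcal{P},\mathcal{G},\mathcal{B})$ be a resolvable transversal design $\mathrm{TD}(q-1,q)$ with groups $G_1,\dots,G_{q-1}$, and label the points of each group as $G_i=\{p_{i,1},\dots,p_{i,q}\}$. Let $\mathcal{C}_3(q)$ be the combinatorial batch code whose servers are the $q^2-q-1$ points in $\mathcal{P}\setminus\{p_{1,1}\}$ and whose items are the blocks in $\mathcal{B}$ that do not contain $p_{1,1}$, together with the $q-3$ sets $\{p_{i,2},p_{i,3},\dots,p_{i,q}\}$, $1\leq i\leq q-3$, where an item is stored in exactly those servers that are the points it contains. Then $\mathcal{C}_3(q)$ is an optimal $(q-1)$-uniform $(q^2-3,\; (q-1)(q^2-3),\; q^2-q-1,\; q^2-q-1)$-CBC, attaining the upper bound $$n(m,c,k)\leq \left\lfloor\frac{(k-1)\binom{m}{c}}{\binom{k-1}{c}}\right\rfloor$$ with $m=k=q^2-q-1$ and $c=q-1$; that is, its number of items $q^2-3$ equals $n(m,c,k)$ and equals the right-hand side of this bound.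
   Context: An $(n,N,k,m)$-CBC (combinatorial batch code) consists of a set $\mathcal{S}$ of $m$ servers and $n$ items $x_1,\dots,x_n$, where item $x_j$ is stored in the servers of a subset $X_j\subseteq\mathcal{S}$, with total storage $\sum_{j=1}^n|X_j|=N$, such that any $k$ items can be retrieved by reading at most one item from each server; that is, for any $k$ distinct indices $i_1,\dots,i_k$ there exist pairwise distinct servers $s_1,\dots,s_k$ with $s_j\in X_{i_j}$ for all $j$. It is $c$-uniform if $|X_j|=c$ for every $j$ (so $N=cn$). $n(m,c,k)$ denotes the maximum $n$ for which a $c$-uniform $(n,cn,k,m)$-CBC exists; a $c$-uniform $(n,cn,k,m)$-CBC is optimal if $n=n(m,c,k)$. The displayed upper bound on $n(m,c,k)$ is a known result from earlier literature. A transversal design $\mathrm{TD}(\ell,h)$ is a triple $(\mathcal{P},\mathcal{G},\mathcal{B})$ where $\mathcal{P}$ is a set of $\ell h$ points; $\mathcal{G}$ is a partition of $\mathcal{P}$ into $\ell$ sets (groups), each of size $h$; $\mathcal{B}$ is a collection of $\ell$-subsets of $\mathcal{P}$ (blocks); each block meets each group in exactly one point; and any pair of points from different groups is contained in exactly one block. It is resolvable if $\mathcal{B}$ can be partitioned into $h$ sets (parallel classes), each containing $h$ blocks, such that each point is contained in exactly one block of each parallel class. -}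

module Defs where

open import Data.Nat using (ℕ; zero; suc; _+_; _*_; _∸_; _^_; _/_; _≤_; _<_; s≤s; z≤n; NonZero; >-nonZero)
open import Data.Nat.Properties using
  (≤-trans; ≤-reflexive; m≤m+n; m+n≤o⇒m≤o∸n; *-identityʳ; *-monoˡ-≤;
   +-assoc; +-identityʳ; +-monoˡ-≤; +-monoʳ-≤; module ≤-Reasoning)
open import Data.Nat.Combinatorics using (_C_; nCk+nC[k+1]≡[n+1]C[k+1])
open import Data.Nat.Primality using (Prime)
open import Data.Fin using (Fin; zero; suc; inject₁)
open import Data.Fin.Subset using (Subset; _∈_; _⊆_; ∣_∣; ⊤; _-_; ⁅_⁆; ⋃)
open import Data.Fin.Subset.Properties using (_∈?_)
open import Data.List using (List; length; lookup; map; sum; filter; tabulate; concat; _++_)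
open import Data.List.Membership.Propositional using () renaming (_∈_ to _∈ˡ_)
open import Data.List.Relation.Unary.All using (All)
open import Data.List.Relation.Unary.Unique.Propositional using (Unique)
open import Data.List.Relation.Binary.Permutation.Propositional using (_↭_)
open import Data.Product using (∃; ∃₂; ∃!; _×_)
open import Function.Bundles using (_⇔_)
open import Function.Definitions using (Injective)
open import Relation.Binary.PropositionalEquality using (_≡_; _≢_; cong)
open import Relation.Nullary.Decidable using (¬?)

PrimePower : ℕ → Set
PrimePower q = ∃₂ λ p e → Prime p × 1 ≤ e × q ≡ p ^ e

-- The servers form a subset of an ambient finite set Fin v.  An item is
-- given by the set of servers storing it; several items may share the
-- same set, so the items form an indexed family (a list).
record StorageSystem (v : ℕ) : Set where
  field
    servers : Subset v
    items   : List (Subset v)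

open StorageSystem public

record IsCBC {v} (n N k m : ℕ) (S : StorageSystem v) : Set where
  field
    stored-in-servers : All (_⊆ servers S) (items S)
    server-count      : ∣ servers S ∣ ≡ m
    item-count        : length (items S) ≡ n
    total-storage     : sum (map ∣_∣ (items S)) ≡ N
    retrieval         : (i : Fin k → Fin (length (items S))) → Injective _≡_ _≡_ i →
                        ∃ λ (s : Fin k → Fin v) →
                          Injective _≡_ _≡_ s × (∀ j → s j ∈ lookup (items S) (i j))

Uniform : ∀ {v} → ℕ → StorageSystem v → Set
Uniform c S = All (λ X → ∣ X ∣ ≡ c) (items S)

IsUniformCBC : ∀ {v} → (c n k m : ℕ) → StorageSystem v → Set
IsUniformCBC c n k m S = Uniform c S × IsCBC n (c * n) k m S

UniformCBCExists : (m c k n : ℕ) → Set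
UniformCBCExists m c k n = ∃ λ v → ∃ λ (S : StorageSystem v) → IsUniformCBC c n k m S

-- IsMaxItems m c k n  says  n = n(m,c,k).
IsMaxItems : (m c k n : ℕ) → Set
IsMaxItems m c k n =
  UniformCBCExists m c k n × (∀ n′ → UniformCBCExists m c k n′ → n′ ≤ n)

IsOptimalUniformCBC : ∀ {v} → (c n k m : ℕ) → StorageSystem v → Set
IsOptimalUniformCBC c n k m S = IsUniformCBC c n k m S × IsMaxItems m c k n

C-pos : ∀ {n k} → k ≤ n → 0 < n C k
C-pos {_}     {zero}  z≤n       = s≤s z≤n
C-pos {suc n} {suc k} (s≤s k≤n) =
  ≤-trans (C-pos k≤n)
    (≤-trans (m≤m+n (n C k) (n C suc k))
             (≤-reflexive (nCk+nC[k+1]≡[n+1]C[k+1] n k)))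

C-nonZero : ∀ {c k} → c < k → NonZero ((k ∸ 1) C c)
C-nonZero {k = suc _} (s≤s c≤k) = >-nonZero (C-pos c≤k)

-- _/_ on ℕ is the floor of the quotient; c < k makes the divisor nonzero.
upperBound : (m c k : ℕ) → .(c < k) → ℕ
upperBound m c k c<k = _/_ ((k ∸ 1) * (m C c)) ((k ∸ 1) C c) {{C-nonZero c<k}}

record TransversalDesign (ℓ h : ℕ) : Set where
  Point : Set
  Point = Fin (ℓ * h)

  field
    group        : Fin ℓ → Subset (ℓ * h)
    partition    : (x : Point) → ∃! _≡_ λ i → x ∈ group i
    group-size   : ∀ i → ∣ group i ∣ ≡ h
    blocks       : List (Subset (ℓ * h))
    distinct     : Unique blocks
    block-size   : All (λ B → ∣ B ∣ ≡ ℓ) blocks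
    block-group  : ∀ {B} → B ∈ˡ blocks → ∀ i → ∃! _≡_ λ x → x ∈ B × x ∈ group i
    pair-block   : ∀ {i j} → i ≢ j → ∀ {x y} → x ∈ group i → y ∈ group j →
                   ∃! _≡_ λ B → B ∈ˡ blocks × x ∈ B × y ∈ B

-- As the blocks are pairwise distinct, concatenating the classes to a
-- permutation of the list of blocks means partitioning the set of blocks.
record Resolvable {ℓ h} (D : TransversalDesign ℓ h) : Set where
  open TransversalDesign D
  field
    class           : Fin h → List (Subset (ℓ * h))
    class-partition : concat (tabulate class) ↭ blocks
    class-size      : ∀ r → length (class r) ≡ h
    class-parallel  : ∀ r (x : Point) → ∃! _≡_ λ B → B ∈ˡ class r × x ∈ B

record Labelling {ℓ h} (D : TransversalDesign ℓ h) : Set where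
  open TransversalDesign D
  field
    label           : Fin ℓ → Fin h → Point
    label-injective : ∀ i → Injective _≡_ _≡_ (label i)
    label-group     : ∀ i x → x ∈ group i ⇔ (∃ λ j → label i j ≡ x)

-- Indices start at 0, so label zero zero is p₁,₁.  Matching on 3 ≤ q turns
-- q into 3 + r: there are 2 + r groups, and the first r = q ∸ 3 of them
-- provide the additional items.
C₃ : ∀ {q} → 3 ≤ q → (D : TransversalDesign (q ∸ 1) q) → Labelling D →
     StorageSystem ((q ∸ 1) * q)
C₃ (s≤s (s≤s (s≤s {n = r} z≤n))) D L = record
  { servers = ⊤ - p₁₁
  ; items   = filter (λ B → ¬? (p₁₁ ∈? B)) blocks ++ tabulate puncturedGroup
  }
  where
  open TransversalDesign D
  open Labelling L

  p₁₁ : Point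
  p₁₁ = label zero zero

  puncturedGroup : Fin r → Subset ((2 + r) * (3 + r))
  puncturedGroup i =
    ⋃ (tabulate λ (j : Fin (2 + r)) → ⁅ label (inject₁ (inject₁ i)) (suc j) ⁆)

c<k : ∀ {q} → 3 ≤ q → q ∸ 1 < q ^ 2 ∸ q ∸ 1
c<k {q} 3≤q@(s≤s _) = m+n≤o⇒m≤o∸n q (m+n≤o⇒m≤o∸n (q + 1) (begin
  (q + 1) + q  ≤⟨ +-monoˡ-≤ q (+-monoʳ-≤ q (s≤s z≤n)) ⟩
  (q + q) + q  ≡⟨ +-assoc q q q ⟩
  q + (q + q)  ≡⟨ cong (λ z → q + (q + z)) (+-identityʳ q) ⟨
  3 * q        ≤⟨ *-monoˡ-≤ q 3≤q ⟩
  q * q        ≡⟨ cong (q *_) (*-identityʳ q) ⟨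
  q ^ 2        ∎))
  where open ≤-Reasoning

{-# OPTIONS --safe #-}

-- Optimality: if k = m, at most m − 1 items avoid a given server, and counting pairs
-- (server, item not stored in it) gives n (m − c) ≤ m (m − 1).
--
-- Retrieval is Hall's condition: a set W of servers missing at least one server contains
-- at most |W| items.  Put W′ = W ∪ {p₁₁} and let A ≤ B be the two smallest sizes of the
-- intersections of W′ with the groups, so that |W′| ≥ A + (q − 2) B.  A block is determined
-- by its points in the corresponding two groups, hence the number N of blocks contained in
-- W and avoiding p₁₁ is at most A B, and N + A + B ≤ A B + q because p₁₁ lies on q blocks.
-- As A ≤ q − 1 and there are only q − 3 punctured groups, this suffices.
module Submission where

open import Defs
open import Data.Bool using (if_then_else_)
open import Data.Fin using
  (Fin; zero; suc; _≟_; inject₁; punchIn; punchOut; combine; quotient; remainder)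
open import Data.Fin.Properties using
  (suc-injective; 0≢1+n; any?; inject₁-injective; punchInᵢ≢i; punchOut-injective;
   combine-injective; combine-remQuot)
open import Data.Fin.Subset using
  (Subset; _∈_; _∉_; _⊆_; ∣_∣; ⊤; ⊥; _∩_; _∪_; _-_; ⁅_⁆; ⋃; inside; outside)
open import Data.Fin.Subset.Properties
open import Data.List using (List; []; _∷_; length; lookup; filter; tabulate; map; _++_)
open import Data.List.Membership.Propositional.Properties using (∈-lookup)
open import Data.List.Properties using (tabulate-lookup; filter-++; length-++; length-tabulate)
open import Data.List.Relation.Unary.All as All using (All; []; _∷_)
open import Data.List.Relation.Unary.All.Properties using (tabulate⁺; filter⁺; all-filter; ++⁺)
open import Data.List.Relation.Unary.AllPairs using (_∷_)
open import Data.List.Relation.Unary.Any using (index)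
open import Data.List.Relation.Unary.Any.Properties using (lookup-index)
open import Data.List.Relation.Unary.Unique.Propositional using (Unique)
open import Data.Nat hiding (_≟_; ∣_-_∣)
open import Data.Nat.Combinatorics using (_C_; nCk≡n!/k![n-k]!; k![n∸k]!∣n!)
open import Data.Nat.DivMod using (m/n*n≡m; m<n*o⇒m/o<n; m*n/n≡m; /-monoˡ-≤)
import Data.Nat.ListAction as ListAction
open import Data.Nat.Properties hiding (_≟_; suc-injective; 0≢1+n)
open import Data.Nat.Tactic.RingSolver using (solve-∀)
open import Data.Product using (∃; ∃₂; _×_; _,_; proj₁; proj₂)
open import Data.Sum using (inj₁; inj₂; [_,_]′)
open import Data.Vec using ([]; _∷_)
open import Function using (_∘_)
open import Function.Bundles using (Equivalence)
open import Function.Definitions using (Injective)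
open import Level using (0ℓ)
open import Relation.Binary.PropositionalEquality
open import Relation.Nullary using (Dec; yes; no; ¬_; does; contradiction)
open import Relation.Nullary.Decidable using (¬?; _×-dec_; decidable-stable)
open import Relation.Unary using (Pred; Decidable)
open import Relation.Unary.Properties using (U?)
open import Algebra.Properties.CommutativeMonoid.Sum +-0-commutativeMonoid
  using (sum; ∑-distrib-+; ∑-comm; sum-remove)

private
  variable
    k n m v : ℕ

-- Counting in finite sets

𝟙 : {A : Set} → Dec A → ℕ
𝟙 a? = if does a? then 1 else 0

𝟙≤1 : {A : Set} (a? : Dec A) → 𝟙 a? ≤ 1
𝟙≤1 (yes _) = ≤-refl
𝟙≤1 (no _)  = z≤n

1≤𝟙 : {A : Set} (a? : Dec A) → A → 1 ≤ 𝟙 a?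
1≤𝟙 (yes _) _ = ≤-refl
1≤𝟙 (no ¬a) a = contradiction a ¬a

𝟙-mono : {A B : Set} (a? : Dec A) (b? : Dec B) → (A → B) → 𝟙 a? ≤ 𝟙 b?
𝟙-mono (yes a) (yes _) f = ≤-refl
𝟙-mono (yes a) (no ¬b) f = contradiction (f a) ¬b
𝟙-mono (no _)  _       f = z≤n

-- Cardinality is a sum of indicators, so that double counting becomes an interchange of finite
-- sums. Since `𝟙` reads only `does`, decisions with the same Boolean give definitionally equal
-- counts, as the recursion in `∣p∣≡#` requires.
# : {P : Pred (Fin n) 0ℓ} → Decidable P → ℕ
# P? = sum (λ x → 𝟙 (P? x))

sum-mono : {f g : Fin n → ℕ} → (∀ x → f x ≤ g x) → sum f ≤ sum g
sum-mono {zero}  f≤g = z≤n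
sum-mono {suc n} f≤g = +-mono-≤ (f≤g zero) (sum-mono (f≤g ∘ suc))

sum-const-≤ : ∀ c {f : Fin n → ℕ} → (∀ x → c ≤ f x) → n * c ≤ sum f
sum-const-≤ {zero}  c c≤f = z≤n
sum-const-≤ {suc n} c c≤f = +-mono-≤ (c≤f zero) (sum-const-≤ c (c≤f ∘ suc))

sum-supported : ∀ c {f : Fin n → ℕ} {P : Pred (Fin n) 0ℓ} (P? : Decidable P) →
  (∀ x → P x → f x ≤ c) → (∀ x → ¬ P x → f x ≤ 0) → sum f ≤ # P? * c
sum-supported {zero}  c P? on off = z≤n
sum-supported {suc n} c {f} P? on off with P? zero
... | yes p = +-mono-≤ (on zero p) (sum-supported c (P? ∘ suc) (on ∘ suc) (off ∘ suc))
... | no ¬p = +-mono-≤ (off zero ¬p) (sum-supported c (P? ∘ suc) (on ∘ suc) (off ∘ suc))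

module _ {P Q : Pred (Fin n) 0ℓ} (P? : Decidable P) (Q? : Decidable Q) where

  #-mono : (∀ x → P x → Q x) → # P? ≤ # Q?
  #-mono P⊆Q = sum-mono λ x → 𝟙-mono (P? x) (Q? x) (P⊆Q x)

  #-modular : {R S : Pred (Fin n) 0ℓ} (R? : Decidable R) (S? : Decidable S) →
    (∀ x → 𝟙 (P? x) + 𝟙 (Q? x) ≤ 𝟙 (R? x) + 𝟙 (S? x)) → # P? + # Q? ≤ # R? + # S?
  #-modular R? S? h = subst₂ _≤_
    (∑-distrib-+ (𝟙 ∘ P?) (𝟙 ∘ Q?)) (∑-distrib-+ (𝟙 ∘ R?) (𝟙 ∘ S?))
    (sum-mono h)

  #-∪ : {R : Pred (Fin n) 0ℓ} (R? : Decidable R) →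
    (∀ x → R x → ¬ P x → Q x) → # R? ≤ # P? + # Q?
  #-∪ R? h = subst (# R? ≤_) (∑-distrib-+ (𝟙 ∘ P?) (𝟙 ∘ Q?)) (sum-mono covered)
    where
    covered : ∀ x → 𝟙 (R? x) ≤ 𝟙 (P? x) + 𝟙 (Q? x)
    covered x with P? x
    ... | yes p = ≤-trans (𝟙≤1 (R? x)) (s≤s z≤n)
    ... | no ¬p = 𝟙-mono (R? x) (Q? x) (λ r → h x r ¬p)

  #-⊎ : {R : Pred (Fin n) 0ℓ} (R? : Decidable R) → (∀ x → P x → ¬ Q x) →
    (∀ x → P x → R x) → (∀ x → Q x → R x) → # P? + # Q? ≤ # R?
  #-⊎ R? disjoint P⊆R Q⊆R = subst (_≤ # R?) (∑-distrib-+ (𝟙 ∘ P?) (𝟙 ∘ Q?)) (sum-mono packed)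
    where
    packed : ∀ x → 𝟙 (P? x) + 𝟙 (Q? x) ≤ 𝟙 (R? x)
    packed x with P? x | Q? x
    ... | yes p | yes q = contradiction q (disjoint x p)
    ... | yes p | no _  = 1≤𝟙 (R? x) (P⊆R x p)
    ... | no _  | yes q = 1≤𝟙 (R? x) (Q⊆R x q)
    ... | no _  | no _  = z≤n

#-U : ∀ n → # (U? {A = Fin n}) ≡ n
#-U zero    = refl
#-U (suc n) = cong suc (#-U n)

#-none : {P : Pred (Fin n) 0ℓ} (P? : Decidable P) → (∀ x → ¬ P x) → # P? ≤ 0
#-none {zero}  P? ¬P = z≤n
#-none {suc n} P? ¬P with P? zero
... | yes p = contradiction p (¬P zero)
... | no _  = #-none (P? ∘ suc) (¬P ∘ suc)

#-remove : {Q : Pred (Fin n) 0ℓ} (Q? : Decidable Q) (y : Fin n) → Q y →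
  suc (# (λ x → Q? x ×-dec ¬? (x ≟ y))) ≤ # Q?
#-remove {suc n} Q? zero q with Q? zero
... | yes _ = s≤s (#-mono (λ x → Q? (suc x) ×-dec ¬? (suc x ≟ zero)) (Q? ∘ suc) (λ _ → proj₁))
... | no ¬q = contradiction q ¬q
#-remove {suc n} Q? (suc y) q = begin
  suc (𝟙 Q₀? + # Q≢?)
    ≡⟨ +-suc (𝟙 Q₀?) (# Q≢?) ⟨
  𝟙 Q₀? + suc (# Q≢?)
    ≤⟨ +-mono-≤ (𝟙-mono Q₀? (Q? zero) proj₁)
         (s≤s (#-mono Q≢? Q≢′? (λ x (q , x≢) → q , x≢ ∘ cong suc))) ⟩
  𝟙 (Q? zero) + suc (# Q≢′?)
    ≤⟨ +-monoʳ-≤ (𝟙 (Q? zero)) (#-remove (Q? ∘ suc) y q) ⟩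
  # Q? ∎
  where
  open ≤-Reasoning
  Q₀?  = Q? zero ×-dec ¬? (zero ≟ suc y)
  Q≢?  = λ x → Q? (suc x) ×-dec ¬? (suc x ≟ suc y)
  Q≢′? = λ x → Q? (suc x) ×-dec ¬? (x ≟ y)

-- Pigeonhole by induction on the domain: the image of the first element is deleted from the target,
-- and injectivity keeps the later images away from it. As `f` receives the membership proof, it
-- need only be defined on `P`.
#-inject : {P : Pred (Fin n) 0ℓ} {Q : Pred (Fin m) 0ℓ} (P? : Decidable P) (Q? : Decidable Q)
  (f : ∀ x → P x → Fin m) → (∀ x p → Q (f x p)) → (∀ {x y} p p′ → f x p ≡ f y p′ → x ≡ y) →
  # P? ≤ # Q?
#-inject {zero}  P? Q? f f∈Q f-inj = z≤n
#-inject {suc n} P? Q? f f∈Q f-inj with P? zero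
... | no _  = #-inject (P? ∘ suc) Q? (f ∘ suc) (f∈Q ∘ suc) (λ p p′ → suc-injective ∘ f-inj p p′)
... | yes p = ≤-trans
  (s≤s (#-inject (P? ∘ suc) (λ y → Q? y ×-dec ¬? (y ≟ f zero p)) (f ∘ suc)
         (λ x p′ → f∈Q (suc x) p′ , λ eq → 0≢1+n (f-inj p p′ (sym eq)))
         (λ p p′ → suc-injective ∘ f-inj p p′)))
  (#-remove Q? (f zero p) (f∈Q zero p))

#-< : {P : Pred (Fin n) 0ℓ} (P? : Decidable P) (y : Fin n) → ¬ P y → # P? < n
#-< {n} P? y ¬p = subst (# P? <_) (#-U n)
  (≤-trans (s≤s (#-mono P? (λ x → U? x ×-dec ¬? (x ≟ y)) (λ x p → _ , λ { refl → ¬p p })))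
    (#-remove U? y _))

#-unique : {P : Pred (Fin n) 0ℓ} (P? : Decidable P) → (∀ {x y} → P x → P y → x ≡ y) → # P? ≤ 1
#-unique P? unique = #-inject P? (U? {A = Fin 1}) (λ _ _ → zero) _ (λ p p′ _ → unique p p′)

#-complement : {P : Pred (Fin n) 0ℓ} (P? : Decidable P) → # P? + # (λ x → ¬? (P? x)) ≤ n
#-complement {n} P? = subst (# P? + # (λ x → ¬? (P? x)) ≤_) (#-U n)
  (#-⊎ P? (λ x → ¬? (P? x)) U? (λ _ p ¬p → ¬p p) _ _)

∣p∣≡# : (p : Subset n) → ∣ p ∣ ≡ # (_∈? p)
∣p∣≡# []            = refl
∣p∣≡# (inside  ∷ p) = cong suc (∣p∣≡# p)
∣p∣≡# (outside ∷ p) = ∣p∣≡# p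

∣∣-modular : (p q : Subset n) → ∣ p ∪ q ∣ + ∣ p ∩ q ∣ ≡ ∣ p ∣ + ∣ q ∣
∣∣-modular []            []            = refl
∣∣-modular (inside  ∷ p) (inside  ∷ q) =
  cong suc (trans (+-suc _ _) (trans (cong suc (∣∣-modular p q)) (sym (+-suc _ _))))
∣∣-modular (inside  ∷ p) (outside ∷ q) = cong suc (∣∣-modular p q)
∣∣-modular (outside ∷ p) (inside  ∷ q) = trans (cong suc (∣∣-modular p q)) (sym (+-suc _ _))
∣∣-modular (outside ∷ p) (outside ∷ q) = ∣∣-modular p q

-- Deletion is idempotent, so deleting `x` a second time cannot lower the size, as it would if `x`
-- were still present.
x∉p-x : ∀ (p : Subset n) {x} → x ∉ p - x
x∉p-x p {x} x∈ = <-irrefl refl (subst (λ r → ∣ r ∣ < ∣ p - x ∣) (p─q─q≡p─q p ⁅ x ⁆) (x∈p⇒∣p-x∣<∣p∣ x∈))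

-- The pair of `f` and `g` embeds `P` into the product of `A` and `B`. The count runs over the
-- fibres of `f`: those over `A` embed into `B` by `g`, all others are empty.
#-product : ∀ {b} {P : Pred (Fin b) 0ℓ} {A : Pred (Fin n) 0ℓ} {B : Pred (Fin m) 0ℓ}
  (P? : Decidable P) (A? : Decidable A) (B? : Decidable B) (f : Fin b → Fin n) (g : Fin b → Fin m) →
  (∀ x → P x → A (f x)) → (∀ x → P x → B (g x)) →
  (∀ {x y} → f x ≡ f y → g x ≡ g y → x ≡ y) → # P? ≤ # A? * # B?
#-product P? A? B? f g P⊆A P⊆B fg-inj = begin
  # P?
    ≤⟨ sum-mono (λ x → fibre x (P? x)) ⟩
  sum (λ x → # (λ a → P? x ×-dec (f x ≟ a)))
    ≡⟨ ∑-comm (λ x a → 𝟙 (P? x ×-dec (f x ≟ a))) ⟩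
  sum (λ a → # (λ x → P? x ×-dec (f x ≟ a)))
    ≤⟨ sum-supported (# B?) A?
         (λ a _ → #-inject (λ x → P? x ×-dec (f x ≟ a)) B? (λ x _ → g x) (λ x (p , _) → P⊆B x p)
                    (λ (_ , fx≡a) (_ , fy≡a) → fg-inj (trans fx≡a (sym fy≡a))))
         (λ a ¬A → #-none (λ x → P? x ×-dec (f x ≟ a)) λ { x (p , refl) → ¬A (P⊆A x p) }) ⟩
  # A? * # B? ∎
  where
  open ≤-Reasoning
  fibre : ∀ x (p? : Dec _) → 𝟙 p? ≤ # (λ a → p? ×-dec (f x ≟ a))
  fibre x (no _)  = z≤n
  fibre x (yes p) = ≤-trans (s≤s z≤n) (#-remove (λ a → yes p ×-dec (f x ≟ a)) (f x) (p , refl))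

-- This turns a lower bound on a count into an injective family of indices, the form in which
-- `retrieval` takes its items.
enumerate : {P : Pred (Fin n) 0ℓ} (P? : Decidable P) → k ≤ # P? →
  ∃ λ (e : Fin k → Fin n) → Injective _≡_ _≡_ e × (∀ j → P (e j))
enumerate {k = zero} P? _ = (λ ()) , (λ { {()} }) , λ ()
enumerate {suc n} {k = suc k} P? k≤ with P? zero
... | no _ with e , e-inj , e∈P ← enumerate (P? ∘ suc) k≤ = suc ∘ e , e-inj ∘ suc-injective , e∈P
... | yes p with e , e-inj , e∈P ← enumerate (P? ∘ suc) (s≤s⁻¹ k≤) = e′ , e′-inj , e′∈P
  where
  e′ : Fin (suc k) → Fin (suc n)
  e′ zero    = zero
  e′ (suc j) = suc (e j)
  e′-inj : Injective _≡_ _≡_ e′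
  e′-inj {zero}  {zero}  _  = refl
  e′-inj {suc _} {suc _} eq = cong suc (e-inj (suc-injective eq))
  e′∈P : ∀ j → _
  e′∈P zero    = p
  e′∈P (suc j) = e∈P j

-- Hall's theorem

contained : (Fin k → Subset v) → Subset v → ℕ
contained A W = # (λ j → A j ⊆? W)

-- A set inside both `V` and `W` is counted for the union and for the intersection; one inside only
-- one of them is still counted for the union.
contained-supermodular : (A : Fin k → Subset v) (V W : Subset v) →
  contained A V + contained A W ≤ contained A (V ∪ W) + contained A (V ∩ W)
contained-supermodular A V W =
  #-modular (λ j → A j ⊆? V) (λ j → A j ⊆? W) (λ j → A j ⊆? V ∪ W) (λ j → A j ⊆? V ∩ W) pointwise
  where
  pointwise : ∀ j → 𝟙 (A j ⊆? V) + 𝟙 (A j ⊆? W) ≤ 𝟙 (A j ⊆? V ∪ W) + 𝟙 (A j ⊆? V ∩ W)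
  pointwise j with A j ⊆? V | A j ⊆? W
  ... | yes a | yes b = +-mono-≤ (1≤𝟙 (A j ⊆? V ∪ W) (λ x∈ → p⊆p∪q W (a x∈)))
                                 (1≤𝟙 (A j ⊆? V ∩ W) (λ x∈ → x∈p∩q⁺ (a x∈ , b x∈)))
  ... | yes a | no _  = ≤-trans (1≤𝟙 (A j ⊆? V ∪ W) (λ x∈ → p⊆p∪q W (a x∈))) (m≤m+n _ _)
  ... | no _  | yes b = ≤-trans (1≤𝟙 (A j ⊆? V ∪ W) (λ x∈ → q⊆p∪q V W (b x∈))) (m≤m+n _ _)
  ... | no _  | no _  = z≤n

Tight : (Fin k → Subset v) → Subset v → Set
Tight A W = ∣ W ∣ ≤ contained A W

-- Hall's condition, indexed by sets of representatives instead of subfamilies; the usual form is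
-- the case where `W` is the union of a subfamily.
Hall : (Fin k → Subset v) → Set
Hall {v = v} A = (W : Subset v) → contained A W ≤ ∣ W ∣

-- Size is modular while `contained` is supermodular, so Hall's bound at `V ∩ W` leaves no slack at
-- `V ∪ W`.
tight-∪ : (A : Fin k → Subset v) → Hall A → ∀ V W → Tight A V → Tight A W → Tight A (V ∪ W)
tight-∪ A hall V W tV tW = +-cancelʳ-≤ ∣ V ∩ W ∣ ∣ V ∪ W ∣ (contained A (V ∪ W)) (begin
  ∣ V ∪ W ∣ + ∣ V ∩ W ∣                      ≡⟨ ∣∣-modular V W ⟩
  ∣ V ∣ + ∣ W ∣                              ≤⟨ +-mono-≤ tV tW ⟩
  contained A V + contained A W              ≤⟨ contained-supermodular A V W ⟩
  contained A (V ∪ W) + contained A (V ∩ W)  ≤⟨ +-monoʳ-≤ _ (hall (V ∩ W)) ⟩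
  contained A (V ∪ W) + ∣ V ∩ W ∣            ∎)
  where open ≤-Reasoning

tight-⊥ : (A : Fin k → Subset v) → Tight A ⊥
tight-⊥ {v = v} A = ≤-trans (≤-reflexive (∣⊥∣≡0 v)) z≤n

tight-⋃ : (A : Fin k → Subset v) → Hall A → ∀ {Ws} → All (Tight A) Ws → Tight A (⋃ Ws)
tight-⋃ A hall []       = tight-⊥ A
tight-⋃ A hall (t ∷ ts) = tight-∪ A hall _ _ t (tight-⋃ A hall ts)

⊆⋃-tabulate : (f : Fin n → Subset v) (i : Fin n) → f i ⊆ ⋃ (tabulate f)
⊆⋃-tabulate f zero    = p⊆p∪q _
⊆⋃-tabulate f (suc i) = q⊆p∪q (f zero) _ ∘ ⊆⋃-tabulate (f ∘ suc) i

-- A representative x of the first set preserves Hall's condition for the others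
-- unless x lies in a set that is tight for them.  Tight sets are closed under
-- union, so if every x were excluded, a tight set would contain the first set.
hall-theorem : (A : Fin k → Subset v) → Hall A →
  ∃ λ (s : Fin k → Fin v) → Injective _≡_ _≡_ s × (∀ j → s j ∈ A j)
hall-theorem {zero}  A hall = (λ ()) , (λ { {()} }) , λ ()
hall-theorem {suc k} {v} A hall with any? (λ x → (x ∈? A zero) ×-dec ¬? (tightAround? x))
  where
  tightAround? : ∀ x → Dec (∃ λ W → x ∈ W × Tight (A ∘ suc) W)
  tightAround? x = anySubset? (λ W → (x ∈? W) ×-dec (∣ W ∣ ≤? contained (A ∘ suc) W))
-- `T` contains at least `∣ T ∣` of the later sets, and `A zero` besides: one more than Hall's
-- condition at `T` allows.
... | no none = contradiction
        (≤-trans (≤-trans (+-monoˡ-≤ _ (1≤𝟙 (A zero ⊆? T) A₀⊆T)) (hall T)) T-tight)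
        (<-irrefl refl)
  where
  rest = A ∘ suc
  tightFor : ∀ x → ∃ λ W → (x ∈ A zero → x ∈ W) × Tight rest W
  tightFor x with anySubset? (λ W → (x ∈? W) ×-dec (∣ W ∣ ≤? contained rest W))
  ... | yes (W , x∈W , tW) = W , (λ _ → x∈W) , tW
  -- By `none` this case occurs only for `x` outside `A zero`; the empty set is a harmless default
  -- that lets `T` be a union over all `x`.
  ... | no ¬tight          = ⊥ , (λ x∈A → contradiction (x , x∈A , ¬tight) none) , tight-⊥ rest
  T = ⋃ (tabulate (proj₁ ∘ tightFor))
  T-tight : Tight rest T
  T-tight = tight-⋃ rest (λ W → ≤-trans (m≤n+m _ (𝟙 (A zero ⊆? W))) (hall W))
    (tabulate⁺ (proj₂ ∘ proj₂ ∘ tightFor))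
  A₀⊆T : A zero ⊆ T
  A₀⊆T {x} x∈A = ⊆⋃-tabulate (proj₁ ∘ tightFor) x (proj₁ (proj₂ (tightFor x)) x∈A)
... | yes (x , x∈A₀ , ¬tight) = extend (hall-theorem rest hall-rest)
  where
  rest : Fin k → Subset v
  rest j = A (suc j) - x

  hall-rest : Hall rest
  -- Putting `x` back into `W` costs at most one element, but the enlarged set contains `x` and so
  -- is not tight, which gains that element back.
  hall-rest W = s≤s⁻¹ (begin
    suc (contained rest W)                  ≤⟨ s≤s (#-mono (λ j → rest j ⊆? W)
                                                 (λ j → A (suc j) ⊆? W ∪ ⁅ x ⁆) enlarge) ⟩
    suc (contained (A ∘ suc) (W ∪ ⁅ x ⁆))   ≤⟨ ≰⇒> (λ t → ¬tight (_ , q⊆p∪q W ⁅ x ⁆ (x∈⁅x⁆ x) , t)) ⟩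
    ∣ W ∪ ⁅ x ⁆ ∣                           ≤⟨ m≤m+n _ _ ⟩
    ∣ W ∪ ⁅ x ⁆ ∣ + ∣ W ∩ ⁅ x ⁆ ∣           ≡⟨ ∣∣-modular W ⁅ x ⁆ ⟩
    ∣ W ∣ + ∣ ⁅ x ⁆ ∣                       ≡⟨ cong (∣ W ∣ +_) (∣⁅x⁆∣≡1 x) ⟩
    ∣ W ∣ + 1                               ≡⟨ +-comm ∣ W ∣ 1 ⟩
    suc ∣ W ∣                               ∎)
    where
    open ≤-Reasoning
    enlarge : ∀ j → rest j ⊆ W → A (suc j) ⊆ W ∪ ⁅ x ⁆
    enlarge j A⊆W {y} y∈A with y ≟ x
    ... | yes refl = q⊆p∪q W ⁅ x ⁆ (x∈⁅x⁆ x)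
    ... | no y≢x   = p⊆p∪q ⁅ x ⁆ (A⊆W (x∈p∧x≢y⇒x∈p-y y∈A y≢x))

  extend : (∃ λ (s : Fin k → Fin v) → Injective _≡_ _≡_ s × (∀ j → s j ∈ rest j)) →
           ∃ λ (s : Fin (suc k) → Fin v) → Injective _≡_ _≡_ s × (∀ j → s j ∈ A j)
  extend (s , s-inj , s∈) = s′ , s′-inj , s′∈
    where
    s′ : Fin (suc k) → Fin v
    s′ zero    = x
    s′ (suc j) = s j
    s′-inj : Injective _≡_ _≡_ s′
    s′-inj {zero}  {zero}  _  = refl
    s′-inj {zero}  {suc j} eq = contradiction (subst (_∈ rest j) (sym eq) (s∈ j)) (x∉p-x (A _))
    s′-inj {suc i} {zero}  eq = contradiction (subst (_∈ rest i) eq (s∈ i)) (x∉p-x (A _))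
    s′-inj {suc i} {suc j} eq = cong suc (s-inj eq)
    s′∈ : ∀ j → s′ j ∈ A j
    s′∈ zero    = x∈A₀
    s′∈ (suc j) = p─q⊆p (A (suc j)) ⁅ x ⁆ (s∈ j)

-- Counting in lists

length-filter-tabulate : {A : Set} {P : Pred A 0ℓ} (P? : Decidable P) (f : Fin n → A) →
  length (filter P? (tabulate f)) ≡ # (P? ∘ f)
length-filter-tabulate {zero}  P? f = refl
length-filter-tabulate {suc n} P? f with P? (f zero)
... | yes _ = cong suc (length-filter-tabulate P? (f ∘ suc))
... | no _  = length-filter-tabulate P? (f ∘ suc)

length-filter-lookup : {A : Set} {P : Pred A 0ℓ} (P? : Decidable P) (xs : List A) →
  length (filter P? xs) ≡ # (P? ∘ lookup xs)
length-filter-lookup P? xs = subst (λ ys → length (filter P? ys) ≡ # (P? ∘ lookup xs))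
  (tabulate-lookup xs) (length-filter-tabulate P? (lookup xs))

filter-filter : {A : Set} {P Q : Pred A 0ℓ} (P? : Decidable P) (Q? : Decidable Q) (xs : List A) →
  filter P? (filter Q? xs) ≡ filter (λ x → Q? x ×-dec P? x) xs
filter-filter P? Q? []       = refl
filter-filter P? Q? (x ∷ xs) with Q? x
... | no _  = filter-filter P? Q? xs
... | yes _ with P? x
...   | yes _ = cong (x ∷_) (filter-filter P? Q? xs)
...   | no _  = filter-filter P? Q? xs

lookup-injective : {A : Set} {xs : List A} → Unique xs → Injective _≡_ _≡_ (lookup xs)
lookup-injective (_  ∷ _)  {zero}  {zero}  _  = refl
lookup-injective (x≢ ∷ _)  {zero}  {suc j} eq = contradiction eq (All.lookup x≢ (∈-lookup j))
lookup-injective (x≢ ∷ _)  {suc i} {zero}  eq = contradiction (sym eq) (All.lookup x≢ (∈-lookup i))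
lookup-injective (_  ∷ xs) {suc i} {suc j} eq = cong suc (lookup-injective xs eq)

sum-map-const : ∀ {A : Set} {c} (f : A → ℕ) {xs : List A} → All (λ x → f x ≡ c) xs →
  ListAction.sum (map f xs) ≡ c * length xs
sum-map-const {c = c} f []                      = sym (*-zeroʳ c)
sum-map-const {c = c} f {_ ∷ xs} (fx≡c ∷ fxs≡c) =
  trans (cong₂ _+_ fx≡c (sum-map-const f fxs≡c)) (sym (*-suc c (length xs)))

-- The upper bound for k = m

module _ {v c n k} {S : StorageSystem v} (cbc : IsUniformCBC c n (suc k) (suc k) S) where

  private
    module C = IsCBC (proj₂ cbc)
    X = lookup (items S)

  -- Retrieving `suc k` items that all avoid `s` would take `suc k` distinct servers among the `k`
  -- servers other than `s`.
  items-avoiding-≤ : ∀ s → s ∈ servers S → # (λ t → ¬? (s ∈? X t)) ≤ k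
  items-avoiding-≤ s s∈S = ≮⇒≥ λ k< →
    let e , e-inj , s∉Xe = enumerate (λ t → ¬? (s ∈? X t)) k<
        r , r-inj , r∈X  = C.retrieval e e-inj
    in <-irrefl refl (begin-strict
      suc k                        ≡⟨ #-U (suc k) ⟨
      # (U? {A = Fin (suc k)})     ≤⟨ #-inject U? (_∈? (servers S - s)) (λ j _ → r j)
                                        (λ j _ → x∈p∧x≢y⇒x∈p-y
                                          (All.lookup C.stored-in-servers (∈-lookup (e j)) (r∈X j))
                                          λ eq → s∉Xe j (subst (_∈ X (e j)) eq (r∈X j)))
                                        (λ _ _ → r-inj) ⟩
      # (_∈? (servers S - s))      ≡⟨ ∣p∣≡# (servers S - s) ⟨
      ∣ servers S - s ∣            <⟨ x∈p⇒∣p-x∣<∣p∣ s∈S ⟩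
      ∣ servers S ∣                ≡⟨ C.server-count ⟩
      suc k                        ∎)
    where open ≤-Reasoning

  -- Both sides bound the number of pairs of a server and an item not stored in it.
  cbc-bound : n * (suc k ∸ c) ≤ suc k * k
  cbc-bound = begin
    n * (suc k ∸ c)
      ≡⟨ cong (_* (suc k ∸ c)) C.item-count ⟨
    length (items S) * (suc k ∸ c)
      ≤⟨ sum-const-≤ (suc k ∸ c) servers-missed-≥ ⟩
    sum (λ t → # (λ s → avoids s t))
      ≡⟨ ∑-comm (λ t s → 𝟙 (avoids s t)) ⟩
    sum (λ s → # (λ t → avoids s t))
      ≤⟨ sum-supported k (_∈? servers S)
           (λ s s∈S → ≤-trans
             (#-mono (avoids s) (λ t → ¬? (s ∈? X t)) (λ _ → proj₂)) (items-avoiding-≤ s s∈S))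
           (λ s s∉S → #-none (avoids s) (λ _ → s∉S ∘ proj₁)) ⟩
    # (_∈? servers S) * k
      ≡⟨ cong (_* k) (trans (sym (∣p∣≡# (servers S))) C.server-count) ⟩
    suc k * k ∎
    where
    open ≤-Reasoning
    avoids : ∀ s t → Dec (s ∈ servers S × s ∉ X t)
    avoids s t = (s ∈? servers S) ×-dec ¬? (s ∈? X t)
    servers-missed-≥ : ∀ t → suc k ∸ c ≤ # (λ s → avoids s t)
    servers-missed-≥ t = m≤n+o⇒m∸n≤o (suc k) c (begin
      suc k                  ≡⟨ C.server-count ⟨
      ∣ servers S ∣          ≡⟨ ∣p∣≡# (servers S) ⟩
      # (_∈? servers S)      ≤⟨ #-∪ (_∈? X t) (λ s → avoids s t) (_∈? servers S) (λ _ → _,_) ⟩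
      # (_∈? X t) + missed   ≡⟨ cong (_+ missed) (∣p∣≡# (X t)) ⟨
      ∣ X t ∣ + missed       ≡⟨ cong (_+ missed) (All.lookup (proj₁ cbc) (∈-lookup t)) ⟩
      c + missed             ∎)
      where missed = # (λ s → avoids s t)

-- Evaluating the binomial bound for m = k

nCk*k![n∸k]!≡n! : k ≤ n → (n C k) * (k ! * (n ∸ k) !) ≡ n !
nCk*k![n∸k]!≡n! {k} {n} k≤n =
  trans (cong (_* (k ! * (n ∸ k) !)) (nCk≡n!/k![n-k]! k≤n)) (m/n*n≡m (k![n∸k]!∣n! k≤n))
  where instance _ = k !* (n ∸ k) !≢0

-- After multiplication by `k ! * (n ∸ k) !` both sides equal (n + 1)!.
[1+n∸k]*[1+n]Ck≡[1+n]*nCk : k ≤ n → (suc n ∸ k) * (suc n C k) ≡ suc n * (n C k)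
[1+n∸k]*[1+n]Ck≡[1+n]*nCk {k} {n} k≤n = *-cancelʳ-≡ _ _ (k ! * (n ∸ k) !) (begin
  ((suc n ∸ k) * (suc n C k)) * (k ! * (n ∸ k) !)
    ≡⟨ cong (λ d → (d * (suc n C k)) * (k ! * (n ∸ k) !)) 1+n∸k≡ ⟩
  (suc (n ∸ k) * (suc n C k)) * (k ! * (n ∸ k) !)
    ≡⟨ rearrange (suc (n ∸ k)) (suc n C k) (k !) ((n ∸ k) !) ⟩
  (suc n C k) * (k ! * suc (n ∸ k) !)
    ≡⟨ cong (λ d → (suc n C k) * (k ! * d !)) 1+n∸k≡ ⟨
  (suc n C k) * (k ! * (suc n ∸ k) !)
    ≡⟨ nCk*k![n∸k]!≡n! (m≤n⇒m≤1+n k≤n) ⟩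
  suc n * n !
    ≡⟨ cong (suc n *_) (nCk*k![n∸k]!≡n! k≤n) ⟨
  suc n * ((n C k) * (k ! * (n ∸ k) !))
    ≡⟨ *-assoc (suc n) (n C k) _ ⟨
  suc n * (n C k) * (k ! * (n ∸ k) !) ∎)
  where
  open ≡-Reasoning
  instance _ = k !* (n ∸ k) !≢0
  1+n∸k≡ : suc n ∸ k ≡ suc (n ∸ k)
  1+n∸k≡ = +-∸-assoc 1 k≤n
  rearrange : ∀ a b c d → (a * b) * (c * d) ≡ b * (c * (a * d))
  rearrange = solve-∀

-- By the preceding identity the quotient of binomials is (k + 1) k / (k + 1 - c), and the two
-- inequalities say that its floor is `n`.
upperBound-≡ : ∀ {c k n} (c≤k : c ≤ k) → .{{NonZero (suc k ∸ c)}} →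
  n * (suc k ∸ c) ≤ suc k * k → suc k * k < suc n * (suc k ∸ c) →
  upperBound (suc k) c (suc k) (s≤s c≤k) ≡ n
upperBound-≡ {c} {k} {n} c≤k lower upper = ≤-antisym
  (s≤s⁻¹ (m<n*o⇒m/o<n {n = suc n}
    (*-cancelˡ-< (suc k ∸ c) (k * (suc k C c)) (suc n * (k C c)) (begin-strict
    (suc k ∸ c) * (k * (suc k C c))   ≡⟨ scaled ⟩
    (suc k * k) * (k C c)             <⟨ *-monoˡ-< (k C c) upper ⟩
    suc n * (suc k ∸ c) * (k C c)     ≡⟨ swap (suc n) (suc k ∸ c) (k C c) ⟩
    (suc k ∸ c) * (suc n * (k C c))   ∎))))
  (≤-trans (≤-reflexive (sym (m*n/n≡m n (k C c)))) (/-monoˡ-≤ (k C c)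
    (*-cancelˡ-≤ {n * (k C c)} {k * (suc k C c)} (suc k ∸ c) (begin
    (suc k ∸ c) * (n * (k C c))       ≡⟨ swap n (suc k ∸ c) (k C c) ⟨
    n * (suc k ∸ c) * (k C c)         ≤⟨ *-monoˡ-≤ (k C c) lower ⟩
    (suc k * k) * (k C c)             ≡⟨ scaled ⟨
    (suc k ∸ c) * (k * (suc k C c))   ∎))))
  where
  open ≤-Reasoning
  instance _ = C-nonZero (s≤s c≤k)
  swap : ∀ a b c → a * b * c ≡ b * (a * c)
  swap = solve-∀
  scaled : (suc k ∸ c) * (k * (suc k C c)) ≡ (suc k * k) * (k C c)
  scaled = trans (sym (swap k (suc k ∸ c) (suc k C c))) (trans (*-assoc k (suc k ∸ c) (suc k C c))
    (trans (cong (k *_) ([1+n∸k]*[1+n]Ck≡[1+n]*nCk c≤k))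
      (trans (sym (*-assoc k (suc k) _)) (cong (_* (k C c)) (*-comm k (suc k))))))

upperBound-cong : ∀ {c m k k′} → k ≡ k′ → m ≡ k → .(p : c < k) .(p′ : c < k′) →
  upperBound m c k p ≡ upperBound k′ c k′ p′
upperBound-cong refl refl _ _ = refl

-- The code C₃

-- With q = 3 + r: for B ≥ 2 this is (q − 1 − A)(B − 2) ≥ 0.
hall-estimate : ∀ {r A B N g u} → A ≤ 2 + r → A ≤ B → N ≤ A * B → N + (A + B) ≤ A * B + (3 + r) →
  g ≤ r → g ≤ u → A + (1 + r) * B ≤ suc u → N + g ≤ u
-- Two groups are missed: A = B = 0 forces N = 0, and `g ≤ u` alone decides.
hall-estimate {B = zero} {N} {g} _ z≤n N≤ _ _ g≤u _ = ≤-trans (+-monoˡ-≤ g N≤) g≤u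
-- For B = 1 the product bound gives N ≤ A, and A + (q - 2) ≤ u + 1 leaves room for exactly q - 3
-- further items.
hall-estimate {r} {A} {suc zero} {N} {g} {u} _ _ N≤ _ g≤r _ sum≤ = s≤s⁻¹ (begin
  suc (N + g)          ≤⟨ s≤s (+-mono-≤ N≤ g≤r) ⟩
  suc (A * 1 + r)      ≡⟨ eq A r ⟩
  A + (1 + r) * 1      ≤⟨ sum≤ ⟩
  suc u                ∎)
  where
  open ≤-Reasoning
  eq : ∀ A r → suc (A * 1 + r) ≡ A + (1 + r) * 1
  eq = solve-∀
hall-estimate {r} {A} {suc (suc b)} {N} {g} {u} A≤ _ _ N+≤ g≤r _ sum≤ =
  s≤s⁻¹ (≤-trans (+-cancelʳ-≤ (A + B) _ _ (begin
    suc (N + g) + (A + B)               ≤⟨ +-monoˡ-≤ (A + B) (s≤s (+-monoʳ-≤ N g≤r)) ⟩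
    suc (N + r) + (A + B)               ≡⟨ eq₁ N r (A + B) ⟩
    (N + (A + B)) + suc r               ≤⟨ +-monoˡ-≤ (suc r) N+≤ ⟩
    (A * B + (3 + r)) + suc r           ≡⟨ eq₂ A b r ⟩
    (A * b + 2 * A) + 2 * (2 + r)       ≤⟨ product ⟩
    (A + (1 + r) * B) + (A + B)         ∎)) sum≤)
  where
  open ≤-Reasoning
  B = 2 + b
  eq₁ : ∀ N r s → suc (N + r) + s ≡ (N + s) + suc r
  eq₁ = solve-∀
  eq₂ : ∀ A b r → (A * (2 + b) + (3 + r)) + suc r ≡ (A * b + 2 * A) + 2 * (2 + r)
  eq₂ = solve-∀
  eq₃ : ∀ A b r → ((2 + r) * b + 2 * A) + 2 * (2 + r) ≡ (A + (1 + r) * (2 + b)) + (A + (2 + b))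
  eq₃ = solve-∀
  product : (A * b + 2 * A) + 2 * (2 + r) ≤ (A + (1 + r) * B) + (A + B)
  product = subst ((A * b + 2 * A) + 2 * (2 + r) ≤_) (eq₃ A b r)
    (+-monoˡ-≤ (2 * (2 + r)) (+-monoˡ-≤ (2 * A) (*-monoˡ-≤ b A≤)))

-- From a ≤ q - A and b ≤ q - B follows M ≥ A + B - q, and this much is lost from A B. The additive
-- form covers the case where A + B - q is negative.
inclusion-exclusion : ∀ {N M A B a b q} → N + M ≤ A * B → q ≤ a + (b + M) → a + A ≤ q → b + B ≤ q →
  N + (A + B) ≤ A * B + q
inclusion-exclusion {N} {M} {A} {B} {a} {b} {q = q} N+M≤ q≤ a+A≤ b+B≤ = +-cancelʳ-≤ q _ _ (begin
  N + (A + B) + q                    ≤⟨ +-monoʳ-≤ (N + (A + B)) q≤ ⟩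
  N + (A + B) + (a + (b + M))        ≡⟨ eq N M A B a b ⟩
  (N + M) + ((a + A) + (b + B))      ≤⟨ +-mono-≤ N+M≤ (+-mono-≤ a+A≤ b+B≤) ⟩
  A * B + (q + q)                    ≡⟨ +-assoc (A * B) q q ⟨
  A * B + q + q                      ∎)
  where
  open ≤-Reasoning
  eq : ∀ N M A B a b → N + (A + B) + (a + (b + M)) ≡ (N + M) + ((a + A) + (b + B))
  eq = solve-∀

argmin : (f : Fin (suc n) → ℕ) → ∃ λ i → ∀ j → f i ≤ f j
argmin {zero}  f = zero , λ { zero → ≤-refl }
argmin {suc n} f with i , min ← argmin (f ∘ suc) with ≤-total (f zero) (f (suc i))
... | inj₁ f₀≤ = zero , λ { zero → ≤-refl ; (suc j) → ≤-trans f₀≤ (min j) }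
... | inj₂ f₀≥ = suc i , λ { zero → f₀≥ ; (suc j) → min j }

-- The second index minimises `f` away from the first, so each of the `suc n` remaining summands is
-- at least `f j`.
two-smallest : (f : Fin (2 + n) → ℕ) →
  ∃₂ λ i j → i ≢ j × (∀ l → f i ≤ f l) × f i + suc n * f j ≤ sum f
two-smallest f with i , i-min ← argmin f with j , j-min ← argmin (f ∘ punchIn i) =
  i , punchIn i j , punchInᵢ≢i i j ∘ sym , i-min ,
  ≤-trans (+-monoʳ-≤ (f i) (sum-const-≤ _ j-min)) (≤-reflexive (sym (sum-remove {i = i} f)))

∈⋃-tabulate⁻ : (f : Fin n → Subset v) → ∀ {x} → x ∈ ⋃ (tabulate f) → ∃ λ i → x ∈ f i
∈⋃-tabulate⁻ {zero}  f x∈ = contradiction x∈ ∉⊥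
∈⋃-tabulate⁻ {suc n} f x∈ with x∈p∪q⁻ (f zero) _ x∈
... | inj₁ x∈f₀ = zero , x∈f₀
... | inj₂ x∈⋃ with i , x∈fᵢ ← ∈⋃-tabulate⁻ (f ∘ suc) x∈⋃ = suc i , x∈fᵢ

∣⊤-x∣ : (x : Fin (suc n)) → ∣ ⊤ - x ∣ ≡ n
∣⊤-x∣ {n} x = ≤-antisym
  (s≤s⁻¹ (subst (∣ ⊤ - x ∣ <_) (∣⊤∣≡n (suc n)) (x∈p⇒∣p-x∣<∣p∣ {x = x} {p = ⊤} ∈⊤)))
  (s≤s⁻¹ (begin
    suc n                             ≡⟨ ∣⊤∣≡n (suc n) ⟨
    ∣ ⊤ {suc n} ∣                     ≤⟨ p⊆q⇒∣p∣≤∣q∣ cover ⟩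
    ∣ ⁅ x ⁆ ∪ (⊤ - x) ∣               ≤⟨ m≤m+n _ _ ⟩
    ∣ ⁅ x ⁆ ∪ (⊤ - x) ∣ + ∣ ⁅ x ⁆ ∩ (⊤ - x) ∣  ≡⟨ ∣∣-modular ⁅ x ⁆ (⊤ - x) ⟩
    ∣ ⁅ x ⁆ ∣ + ∣ ⊤ - x ∣             ≡⟨ cong (_+ ∣ ⊤ - x ∣) (∣⁅x⁆∣≡1 x) ⟩
    suc ∣ ⊤ - x ∣                     ∎))
  where
  open ≤-Reasoning
  cover : ⊤ ⊆ ⁅ x ⁆ ∪ (⊤ - x)
  cover {y} _ with y ≟ x
  ... | yes refl = p⊆p∪q _ (x∈⁅x⁆ x)
  ... | no y≢x   = q⊆p∪q ⁅ x ⁆ _ (x∈p∧x≢y⇒x∈p-y ∈⊤ y≢x)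

module C₃-Properties {r} (D : TransversalDesign (2 + r) (3 + r)) (L : Labelling D) where
  open TransversalDesign D
  open Labelling L

  private
    q = 3 + r
    ℓ = 2 + r

    Block : Set
    Block = Fin (length blocks)

    blk : Block → Subset (ℓ * q)
    blk = lookup blocks

    p₁₁ : Point
    p₁₁ = label zero zero

  -- Restates the local definition in `C₃`, with which it agrees by unfolding, so that its
  -- properties can be stated.
  puncturedGroup : Fin r → Subset (ℓ * q)
  puncturedGroup i = ⋃ (tabulate λ (j : Fin ℓ) → ⁅ label (inject₁ (inject₁ i)) (suc j) ⁆)

  label∈punctured : ∀ i j → label (inject₁ (inject₁ i)) (suc j) ∈ puncturedGroup i
  label∈punctured i j = ⊆⋃-tabulate (λ j → ⁅ label (inject₁ (inject₁ i)) (suc j) ⁆) j (x∈⁅x⁆ _)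

  punctured⇒label : ∀ i {x} → x ∈ puncturedGroup i → ∃ λ j → x ≡ label (inject₁ (inject₁ i)) (suc j)
  punctured⇒label i x∈ =
    let j , x∈⁅⁆ = ∈⋃-tabulate⁻ (λ j → ⁅ label (inject₁ (inject₁ i)) (suc j) ⁆) x∈ in j , x∈⁅y⁆⇒x≡y _ x∈⁅⁆

  S : StorageSystem (ℓ * q)
  S = C₃ (s≤s (s≤s (s≤s z≤n))) D L

  -- Coordinates of points and blocks

  label∈group : ∀ i a → label i a ∈ group i
  label∈group i a = Equivalence.from (label-group i _) (a , refl)

  group-unique : ∀ {x i j} → x ∈ group i → x ∈ group j → i ≡ j
  group-unique {x} x∈i x∈j with _ , _ , unique ← partition x = trans (sym (unique x∈i)) (unique x∈j)

  label-injective₁ : ∀ {i j a b} → label i a ≡ label j b → i ≡ j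
  label-injective₁ {i} {j} {a} {b} eq =
    group-unique (label∈group i a) (subst (_∈ group j) (sym eq) (label∈group j b))

  label-surjective : ∀ x → ∃₂ λ i a → label i a ≡ x
  label-surjective x with i , x∈i , _ ← partition x = i , Equivalence.to (label-group i x) x∈i

  private
    meet : ∀ i β → ∃ λ a → label i a ∈ blk β
    meet i β with x , (x∈β , x∈i) , _ ← block-group (∈-lookup β) i
             with a , eq ← Equivalence.to (label-group i x) x∈i = a , subst (_∈ blk β) (sym eq) x∈β

  -- A block is a transversal of the groups: it consists of the points label i (coord i β).
  coord : Fin ℓ → Block → Fin q
  coord i β = proj₁ (meet i β)

  coord∈ : ∀ i β → label i (coord i β) ∈ blk β
  coord∈ i β = proj₂ (meet i β)

  coord-unique : ∀ {i a} β → label i a ∈ blk β → coord i β ≡ a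
  coord-unique {i} {a} β a∈ = let _ , _ , unique = block-group (∈-lookup β) i in
    label-injective i (trans (sym (unique (coord∈ i β , label∈group i _))) (unique (a∈ , label∈group i a)))

  -- Both blocks pass through the same two points of different groups, so they are equal as sets;
  -- `distinct` then identifies their positions in the list.
  coord-injective : ∀ {i j} → i ≢ j → ∀ {β γ} → coord i β ≡ coord i γ → coord j β ≡ coord j γ → β ≡ γ
  coord-injective {i} {j} i≢j {β} {γ} eqᵢ eqⱼ
    with _ , _ , unique ← pair-block i≢j (label∈group i (coord i β)) (label∈group j (coord j β)) =
    lookup-injective distinct (trans (sym (unique (∈-lookup β , coord∈ i β , coord∈ j β)))
      (unique (∈-lookup γ , subst (λ a → label i a ∈ blk γ) (sym eqᵢ) (coord∈ i γ)
                          , subst (λ a → label j a ∈ blk γ) (sym eqⱼ) (coord∈ j γ))))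

  private
    join-block : ∀ {i j} → i ≢ j → ∀ a b → ∃ λ β → label i a ∈ blk β × label j b ∈ blk β
    join-block {i} {j} i≢j a b
      with B , (B∈ , a∈B , b∈B) , _ ← pair-block i≢j (label∈group i a) (label∈group j b) =
      index B∈ , subst (label i a ∈_) (lookup-index B∈) a∈B ,
      subst (label j b ∈_) (lookup-index B∈) b∈B

  -- With `coord-injective`, this makes the coordinates in any two groups a bijection between blocks
  -- and pairs in `Fin q`.
  join : ∀ {i j} → i ≢ j → Fin q → Fin q → Block
  join i≢j a b = proj₁ (join-block i≢j a b)

  coord-joinˡ : ∀ {i j} (i≢j : i ≢ j) a b → coord i (join i≢j a b) ≡ a
  coord-joinˡ i≢j a b = coord-unique (join i≢j a b) (proj₁ (proj₂ (join-block i≢j a b)))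

  coord-joinʳ : ∀ {i j} (i≢j : i ≢ j) a b → coord j (join i≢j a b) ≡ b
  coord-joinʳ i≢j a b = coord-unique (join i≢j a b) (proj₂ (proj₂ (join-block i≢j a b)))

  private
    0≢1 : _≢_ {A = Fin ℓ} zero (suc zero)
    0≢1 ()

    through? : ∀ β → Dec (p₁₁ ∈ blk β)
    through? β = p₁₁ ∈? blk β

  -- Joining `p₁₁` to each of the q points of the second group yields distinct blocks.
  through-≥ : q ≤ # through?
  through-≥ = subst (_≤ # through?) (#-U q) (#-inject U? through? (λ b _ → join 0≢1 zero b)
    (λ b _ → proj₁ (proj₂ (join-block 0≢1 zero b)))
    (λ {b} {b′} _ _ eq → trans (sym (coord-joinʳ 0≢1 zero b))
      (trans (cong (coord (suc zero)) eq) (coord-joinʳ 0≢1 zero b′))))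

  -- A block avoids `p₁₁` exactly when its first coordinate is nonzero. This leaves q - 1 = `ℓ`
  -- choices for the first coordinate and q for the second.
  not-through : # (λ β → ¬? (through? β)) ≡ ℓ * q
  not-through = ≤-antisym
    (subst (# off? ≤_) (#-U (ℓ * q)) (#-inject off? U?
      (λ β p₁₁∉β → combine (punchOut (coord₀≢0 β p₁₁∉β)) (coord (suc zero) β)) _
      (λ p p′ eq → let eq₀ , eq₁ = combine-injective _ _ _ _ eq in
         coord-injective 0≢1 (punchOut-injective (coord₀≢0 _ p) (coord₀≢0 _ p′) eq₀) eq₁)))
    (subst (_≤ # off?) (#-U (ℓ * q)) (#-inject U? off?
      (λ x _ → join 0≢1 (suc (quotient {ℓ} q x)) (remainder {ℓ} q x))
      (λ x _ p₁₁∈ → 0≢1+n (trans (sym (coord-unique _ p₁₁∈)) (coord-joinˡ 0≢1 _ _)))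
      (λ {x} {y} _ _ eq → trans (sym (combine-remQuot {ℓ} q x)) (trans
         (cong₂ combine
           (suc-injective (trans (sym (coord-joinˡ 0≢1 _ _))
             (trans (cong (coord zero) eq) (coord-joinˡ 0≢1 _ _))))
           (trans (sym (coord-joinʳ 0≢1 _ _)) (trans (cong (coord (suc zero)) eq) (coord-joinʳ 0≢1 _ _))))
         (combine-remQuot {ℓ} q y)))))
    where
    off? : ∀ β → Dec (p₁₁ ∉ blk β)
    off? β = ¬? (through? β)
    coord₀≢0 : ∀ β → p₁₁ ∉ blk β → zero ≢ coord zero β
    coord₀≢0 β p₁₁∉β eq = p₁₁∉β (subst (λ a → label zero a ∈ blk β) (sym eq) (coord∈ zero β))

  -- Items contained in a set of servers

  module _ (W : Subset (ℓ * q)) where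

    private
      W′ : Subset (ℓ * q)
      W′ = W ∪ ⁅ p₁₁ ⁆

      p₁₁∈W′ : p₁₁ ∈ W′
      p₁₁∈W′ = q⊆p∪q W ⁅ p₁₁ ⁆ (x∈⁅x⁆ p₁₁)

      ∣W′∣≤ : ∣ W′ ∣ ≤ suc ∣ W ∣
      ∣W′∣≤ = begin
        ∣ W′ ∣                           ≤⟨ m≤m+n _ _ ⟩
        ∣ W′ ∣ + ∣ W ∩ ⁅ p₁₁ ⁆ ∣         ≡⟨ ∣∣-modular W ⁅ p₁₁ ⁆ ⟩
        ∣ W ∣ + ∣ ⁅ p₁₁ ⁆ ∣              ≡⟨ cong (∣ W ∣ +_) (∣⁅x⁆∣≡1 p₁₁) ⟩
        ∣ W ∣ + 1                        ≡⟨ +-comm ∣ W ∣ 1 ⟩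
        suc ∣ W ∣                        ∎
        where open ≤-Reasoning

      part? : ∀ i a → Dec (label i a ∈ W′)
      part? i a = label i a ∈? W′

      partSize : Fin ℓ → ℕ
      partSize i = # (part? i)

      inside? : ∀ β → Dec (p₁₁ ∉ blk β × blk β ⊆ W)
      inside? β = ¬? (through? β) ×-dec (blk β ⊆? W)

      punctured? : ∀ i → Dec (puncturedGroup i ⊆ W)
      punctured? i = puncturedGroup i ⊆? W

      ∑-partSize : sum partSize ≤ ∣ W′ ∣
      ∑-partSize = begin
        sum partSize
          ≤⟨ sum-mono (λ i → #-inject (part? i) (λ x → in? x i) (λ a _ → label i a)
               (λ a a∈ → a∈ , label∈group i a) (λ _ _ → label-injective i)) ⟩
        sum (λ i → # (λ x → in? x i))
          ≡⟨ ∑-comm (λ i x → 𝟙 (in? x i)) ⟩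
        sum (λ x → # (in? x))
          ≤⟨ sum-supported 1 (_∈? W′)
               (λ x _ → #-unique (in? x) (λ (_ , x∈i) (_ , x∈j) → group-unique x∈i x∈j))
               (λ x x∉ → #-none (in? x) (λ _ → x∉ ∘ proj₁)) ⟩
        # (_∈? W′) * 1
          ≡⟨ *-identityʳ _ ⟩
        # (_∈? W′)
          ≡⟨ ∣p∣≡# W′ ⟨
        ∣ W′ ∣ ∎
        where
        open ≤-Reasoning
        in? : ∀ x i → Dec (x ∈ W′ × x ∈ group i)
        in? x i = (x ∈? W′) ×-dec (x ∈? group i)

      module _ {i j : Fin ℓ} (i≢j : i ≢ j) where

        private
          both? : ∀ β → Dec (label i (coord i β) ∈ W′ × label j (coord j β) ∈ W′)
          both? β = part? i (coord i β) ×-dec part? j (coord j β)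

        both-≤ : # both? ≤ partSize i * partSize j
        both-≤ = #-product both? (part? i) (part? j) (coord i) (coord j)
          (λ _ → proj₁) (λ _ → proj₂) (coord-injective i≢j)

        inside⇒both : ∀ β → p₁₁ ∉ blk β × blk β ⊆ W →
          label i (coord i β) ∈ W′ × label j (coord j β) ∈ W′
        inside⇒both β (_ , β⊆W) = p⊆p∪q _ (β⊆W (coord∈ i β)) , p⊆p∪q _ (β⊆W (coord∈ j β))

        inside-≤ : # inside? ≤ partSize i * partSize j
        inside-≤ = ≤-trans (#-mono inside? both? inside⇒both) both-≤

        -- Of the q blocks through p₁₁, at most q − A leave W′ in group i and at most
        -- q − B leave it in group j; the remaining ones are not among the items.
        inside+parts-≤ : # inside? + (partSize i + partSize j) ≤ partSize i * partSize j + q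
        inside+parts-≤ = inclusion-exclusion
          {N = # inside?} {M = # through-both?} {A = partSize i} {B = partSize j}
          {a = # (exits? i)} {b = # (exits? j)}
          (≤-trans
            (#-⊎ inside? through-both? both? (λ _ (p₁₁∉β , _) (p₁₁∈β , _) → p₁₁∉β p₁₁∈β)
              inside⇒both (λ _ → proj₂))
            both-≤)
          (≤-trans through-≥
            (≤-trans
              (#-∪ (exits? i) enters? through? (λ β p₁₁∈β ¬exits → p₁₁∈β , remains i β p₁₁∈β ¬exits))
              (+-monoʳ-≤ (# (exits? i))
                (#-∪ (exits? j) through-both? enters?
                  (λ β (p₁₁∈β , ∈ᵢ) ¬exits → p₁₁∈β , ∈ᵢ , remains j β p₁₁∈β ¬exits)))))
          (exits-≤ i) (exits-≤ j)
          where
          through-both? : ∀ β → Dec (p₁₁ ∈ blk β × label i (coord i β) ∈ W′ × label j (coord j β) ∈ W′)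
          through-both? β = through? β ×-dec both? β

          enters? : ∀ β → Dec (p₁₁ ∈ blk β × label i (coord i β) ∈ W′)
          enters? β = through? β ×-dec part? i (coord i β)

          exits? : ∀ l β → Dec (p₁₁ ∈ blk β × label l (coord l β) ∉ W′)
          exits? l β = through? β ×-dec ¬? (part? l (coord l β))

          remains : ∀ l β → p₁₁ ∈ blk β → ¬ (p₁₁ ∈ blk β × label l (coord l β) ∉ W′) →
            label l (coord l β) ∈ W′
          remains l β p₁₁∈β ¬exits =
            decidable-stable (part? l (coord l β)) (λ ∉W′ → ¬exits (p₁₁∈β , ∉W′))

          -- In its own group `p₁₁` is the point of the block and lies in `W′`, so no exit occurs
          -- there. In any other group, `p₁₁` and the exit point determine the block.
          exits-injective : ∀ l {β γ} →
            p₁₁ ∈ blk β × label l (coord l β) ∉ W′ → p₁₁ ∈ blk γ × label l (coord l γ) ∉ W′ →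
            coord l β ≡ coord l γ → β ≡ γ
          exits-injective zero {β} (p₁₁∈β , ∉W′) _ _ =
            contradiction (subst (λ a → label zero a ∈ W′) (sym (coord-unique β p₁₁∈β)) p₁₁∈W′) ∉W′
          exits-injective (suc l) {β} {γ} (p₁₁∈β , _) (p₁₁∈γ , _) eq =
            coord-injective (λ ()) (trans (coord-unique β p₁₁∈β) (sym (coord-unique γ p₁₁∈γ))) eq

          exits-≤ : ∀ l → # (exits? l) + partSize l ≤ q
          exits-≤ l = ≤-trans (+-monoˡ-≤ (partSize l)
            (#-inject (exits? l) (λ a → ¬? (part? l a))
              (λ β _ → coord l β) (λ _ → proj₂) (exits-injective l)))
            (≤-trans (≤-reflexive (+-comm (# (λ a → ¬? (part? l a))) (partSize l)))
              (#-complement (part? l)))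

      punctured-≤r : # punctured? ≤ r
      punctured-≤r = subst (# punctured? ≤_) (#-U r) (#-mono punctured? U? _)

      -- One point is taken from each punctured group, and distinct groups are disjoint. This
      -- settles the case B = 0 of `hall-estimate`.
      punctured-≤∣W∣ : # punctured? ≤ ∣ W ∣
      punctured-≤∣W∣ = subst (# punctured? ≤_) (sym (∣p∣≡# W)) (#-inject punctured? (_∈? W)
        (λ i _ → label (inject₁ (inject₁ i)) (suc zero))
        (λ i ⊆W → ⊆W (label∈punctured i zero))
        (λ _ _ eq → inject₁-injective (inject₁-injective (label-injective₁ eq))))

    -- Since `z` lies outside `W′`, the part of `W′` in the group of `z` has at most q - 1 points,
    -- and so has the smallest part.
    inside-count : ∀ z → z ∉ W → z ≢ p₁₁ → # inside? + # punctured? ≤ ∣ W ∣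
    inside-count z z∉W z≢p₁₁ with two-smallest partSize | label-surjective z
    ... | i , j , i≢j , min , sum≤ | l , a , refl = hall-estimate {r}
      (s≤s⁻¹ (≤-<-trans (min l) (#-< (part? l) a λ z∈ →
        [ z∉W , z≢p₁₁ ∘ x∈⁅y⁆⇒x≡y p₁₁ ]′ (x∈p∪q⁻ W ⁅ p₁₁ ⁆ z∈))))
      (min j) (inside-≤ i≢j) (inside+parts-≤ i≢j) punctured-≤r punctured-≤∣W∣
      (≤-trans sum≤ (≤-trans ∑-partSize ∣W′∣≤))

    items-inside-≡ : # (λ t → lookup (items S) t ⊆? W) ≡ # inside? + # punctured?
    items-inside-≡ = begin
      # (λ t → lookup (items S) t ⊆? W)
        ≡⟨ length-filter-lookup (_⊆? W) (items S) ⟨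
      length (filter (_⊆? W) (filter off? blocks ++ tabulate puncturedGroup))
        ≡⟨ cong length (filter-++ (_⊆? W) (filter off? blocks) (tabulate puncturedGroup)) ⟩
      length (filter (_⊆? W) (filter off? blocks) ++ filter (_⊆? W) (tabulate puncturedGroup))
        ≡⟨ length-++ (filter (_⊆? W) (filter off? blocks)) ⟩
      length (filter (_⊆? W) (filter off? blocks)) + length (filter (_⊆? W) (tabulate puncturedGroup))
        ≡⟨ cong₂ _+_ (trans (cong length (filter-filter (_⊆? W) off? blocks))
                            (length-filter-lookup (λ B → off? B ×-dec (B ⊆? W)) blocks))
                     (length-filter-tabulate (_⊆? W) puncturedGroup) ⟩
      # inside? + # punctured? ∎
      where
      open ≡-Reasoning
      off? : ∀ B → Dec (p₁₁ ∉ B)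
      off? B = ¬? (p₁₁ ∈? B)

  -- Retrieval and the parameters of the code

  retrieval : k ≤ ∣ servers S ∣ → (e : Fin k → Fin (length (items S))) → Injective _≡_ _≡_ e →
    ∃ λ (s : Fin k → Fin (ℓ * q)) → Injective _≡_ _≡_ s × (∀ j → s j ∈ lookup (items S) (e j))
  retrieval {k} k≤ e e-inj = hall-theorem A hall
    where
    A : Fin k → Subset (ℓ * q)
    A j = lookup (items S) (e j)

    hall : Hall A
    hall W with any? (λ z → ¬? (z ∈? W) ×-dec ¬? (z ≟ p₁₁))
    ... | yes (z , z∉W , z≢p₁₁) = begin
      contained A W
        ≤⟨ #-inject (λ j → A j ⊆? W) (λ t → lookup (items S) t ⊆? W)
             (λ j _ → e j) (λ j A⊆W → A⊆W) (λ _ _ → e-inj) ⟩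
      # (λ t → lookup (items S) t ⊆? W)
        ≡⟨ items-inside-≡ W ⟩
      _
        ≤⟨ inside-count W z z∉W z≢p₁₁ ⟩
      ∣ W ∣ ∎
      where open ≤-Reasoning
    -- Here `W` contains every server, so the bound on `k` suffices.
    ... | no none = begin
      contained A W        ≤⟨ #-mono (λ j → A j ⊆? W) U? _ ⟩
      # (U? {A = Fin k})   ≡⟨ #-U k ⟩
      k                    ≤⟨ k≤ ⟩
      ∣ ⊤ - p₁₁ ∣          ≤⟨ p⊆q⇒∣p∣≤∣q∣ (λ {z} z∈ → decidable-stable (z ∈? W)
                                λ z∉W → none (z , z∉W , λ { refl → x∉p-x ⊤ z∈ })) ⟩
      ∣ W ∣                ∎
      where open ≤-Reasoning

  stored : All (_⊆ servers S) (items S)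
  stored = ++⁺
    (All.map (λ p₁₁∉B {x} x∈B → x∈p∧x≢y⇒x∈p-y ∈⊤ λ { refl → p₁₁∉B x∈B })
      (all-filter (λ B → ¬? (p₁₁ ∈? B)) blocks))
    (tabulate⁺ λ i {x} x∈ → x∈p∧x≢y⇒x∈p-y ∈⊤ (λ { refl → p₁₁∉punctured i x∈ }))
    where
    p₁₁∉punctured : ∀ i → p₁₁ ∉ puncturedGroup i
    p₁₁∉punctured i p₁₁∈ with punctured⇒label i p₁₁∈
    ... | j , eq = 0≢1+n (label-injective zero
            (trans eq (cong (λ l → label l (suc j)) (sym (label-injective₁ eq)))))

  uniform : Uniform ℓ S
  uniform = ++⁺ (filter⁺ (λ B → ¬? (p₁₁ ∈? B)) block-size) (tabulate⁺ punctured-size)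
    where
    punctured-size : ∀ i → ∣ puncturedGroup i ∣ ≡ ℓ
    punctured-size i = trans (∣p∣≡# (puncturedGroup i)) (≤-antisym
      (subst (# (_∈? puncturedGroup i) ≤_) (#-U ℓ) (#-inject (_∈? puncturedGroup i) U?
        (λ x x∈ → proj₁ (punctured⇒label i x∈)) _
        (λ x∈ y∈ eq → trans (proj₂ (punctured⇒label i x∈))
          (trans (cong (label _ ∘ suc) eq) (sym (proj₂ (punctured⇒label i y∈)))))))
      (subst (_≤ # (_∈? puncturedGroup i)) (#-U ℓ) (#-inject U? (_∈? puncturedGroup i)
        (λ j _ → label (inject₁ (inject₁ i)) (suc j)) (λ j _ → label∈punctured i j)
        (λ _ _ → suc-injective ∘ label-injective _))))

  item-count : length (items S) ≡ ℓ * q + r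
  item-count = trans (length-++ (filter (λ B → ¬? (p₁₁ ∈? B)) blocks)) (cong₂ _+_
    (trans (length-filter-lookup (λ B → ¬? (p₁₁ ∈? B)) blocks) not-through)
    (length-tabulate puncturedGroup))

  isUniformCBC : ∀ {m} → ℓ * q ≡ suc m → IsUniformCBC ℓ (ℓ * q + r) m m S
  isUniformCBC {m} ℓq≡1+m = uniform , record
    { stored-in-servers = stored
    ; server-count      = server-count
    ; item-count        = item-count
    ; total-storage     = trans (sum-map-const ∣_∣ uniform) (cong (ℓ *_) item-count)
    ; retrieval         = retrieval (≤-reflexive (sym server-count))
    }
    where
    server-count : ∣ servers S ∣ ≡ m
    server-count = trans (∣⊤-x∣ p₁₁) (cong pred ℓq≡1+m)

-- Optimality

theorem22 : (q : ℕ) (3≤q : 3 ≤ q) → PrimePower q →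
    (D : TransversalDesign (q ∸ 1) q) → Resolvable D → (L : Labelling D) →
    let n = q ^ 2 ∸ 3
        m = q ^ 2 ∸ q ∸ 1
        k = q ^ 2 ∸ q ∸ 1
        c = q ∸ 1
    in IsOptimalUniformCBC c n k m (C₃ 3≤q D L) × n ≡ upperBound m c k (c<k 3≤q)
theorem22 q 3≤q@(s≤s (s≤s (s≤s {n = r} z≤n))) _ D _ L =
  subst₂ (λ n k → IsOptimalUniformCBC c n k k (C₃ 3≤q D L)) (sym n≡) (sym k≡)
    (cbc , (_ , _ , cbc) , maximal) ,
  trans n≡ (trans (sym (upperBound-≡ c≤k₀ lower upper))
    (sym (upperBound-cong k≡ refl (c<k 3≤q) (s≤s c≤k₀))))
  where
  -- With q = 3 + r, `k₀` is m - 1 = (q - 2)(q + 1), and `n₀` adds the q - 3 punctured groups to the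
  -- (q - 1) q blocks.
  c k₀ n₀ : ℕ
  c  = 2 + r
  k₀ = (1 + r) * (4 + r)
  n₀  = (2 + r) * (3 + r) + r

  n≡ : q ^ 2 ∸ 3 ≡ n₀
  n≡ = cong (_∸ 3) (eq r)
    where
    eq : ∀ r → (3 + r) * ((3 + r) * 1) ≡ 3 + ((2 + r) * (3 + r) + r)
    eq = solve-∀

  k≡ : q ^ 2 ∸ q ∸ 1 ≡ suc k₀
  k≡ = cong (_∸ 1) (trans (cong (_∸ q) (eq r)) (m+n∸m≡n q (2 + k₀)))
    where
    eq : ∀ r → (3 + r) * ((3 + r) * 1) ≡ (3 + r) + (2 + (1 + r) * (4 + r))
    eq = solve-∀

  1+k₀≡ : suc k₀ ≡ c + (1 + r) * (3 + r)
  1+k₀≡ = eq r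
    where
    eq : ∀ r → suc ((1 + r) * (4 + r)) ≡ (2 + r) + (1 + r) * (3 + r)
    eq = solve-∀

  c≤k₀ : c ≤ k₀
  c≤k₀ = s≤s⁻¹ (≤-trans (≤-trans (≤-reflexive (+-comm 1 c)) (+-monoʳ-≤ c (s≤s z≤n)))
    (≤-reflexive (sym 1+k₀≡)))

  1+k₀∸c≡ : suc k₀ ∸ c ≡ (1 + r) * (3 + r)
  1+k₀∸c≡ = trans (cong (_∸ c) 1+k₀≡) (m+n∸m≡n c _)

  instance
    1+k₀∸c≢0 : NonZero (suc k₀ ∸ c)
    1+k₀∸c≢0 = subst NonZero (sym 1+k₀∸c≡) _

  -- Division of m (m - 1) by m - c = (q - 2) q gives quotient `n₀` and remainder (q - 2)(q - 1),
  -- which is q - 2 = 1 + r short of the divisor.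
  lower : n₀ * (suc k₀ ∸ c) ≤ suc k₀ * k₀
  lower = subst (λ d → n₀ * d ≤ suc k₀ * k₀) (sym 1+k₀∸c≡)
    (≤-trans (m≤m+n _ _) (≤-reflexive (sym (eq r))))
    where
    eq : ∀ r → suc ((1 + r) * (4 + r)) * ((1 + r) * (4 + r)) ≡
               ((2 + r) * (3 + r) + r) * ((1 + r) * (3 + r)) + (1 + r) * (2 + r)
    eq = solve-∀

  upper : suc k₀ * k₀ < suc n₀ * (suc k₀ ∸ c)
  upper = subst (λ d → suc k₀ * k₀ < suc n₀ * d) (sym 1+k₀∸c≡)
    (≤-trans (s≤s (m≤m+n _ r)) (≤-reflexive (sym (eq r))))
    where
    eq : ∀ r → suc ((2 + r) * (3 + r) + r) * ((1 + r) * (3 + r)) ≡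
               suc (suc ((1 + r) * (4 + r)) * ((1 + r) * (4 + r)) + r)
    eq = solve-∀

  maximal : ∀ n′ → UniformCBCExists (suc k₀) c (suc k₀) n′ → n′ ≤ n₀
  -- The strict inequality that fixes the floor also caps the number of items of any competing code.
  maximal n′ (_ , _ , cbc′) = s≤s⁻¹
    (*-cancelʳ-< (suc k₀ ∸ c) n′ (suc n₀) (≤-<-trans (cbc-bound cbc′) upper))

  cbc : IsUniformCBC c n₀ (suc k₀) (suc k₀) (C₃ 3≤q D L)
  cbc = C₃-Properties.isUniformCBC D L (eq r)
    where
    eq : ∀ r → (2 + r) * (3 + r) ≡ suc (suc ((1 + r) * (4 + r)))
    eq = solve-∀
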